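{- For every rational number $m$, define $$\begin{aligned} x_1&=(4m+3)(8m-3), & x_2&=-2(2m+3)(12m-1),\\ x_3&=-4(3m+1)(4m-9), & x_4&=6(4m+1)(8m+1),\\ x_5&=3(4m+1)(16m-3), & x_6&=8(4m+3)(m-1),\\ x_7&=-4(16m+9)(2m-1), & y_1&=(8m+1)(4m-9),\\ y_2&=(16m+9)(12m-1), & y_3&=4(2m+3)(4m+3),\\ y_4&=8(3m+1)(8m-3), & y_5&=-6(4m+1)(2m-1),\\ y_6&=-2(4m+1)(16m-3), & y_7&=-12(4m+3)(m-1). \end{aligned}$$ Then $$\sum_{i=1}^7x_i^r=\sum_{i=1}^7y_i^r\quad\text{for } r=1,2,3,4,5,\qquad\text{and}\qquad \prod_{i=1}^7x_i=\prod_{i=1}^7y_i.$$ Moreover, as a parametric solution this is nontrivial: in $\mathbb{Q}[m]$ the multisets $\{x_1,\dots,x_7\}$ and $\{y_1,\dots,y_7\}$ are distinct. -}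

module Defs where

open import Agda.Builtin.FromNat using (Number; fromNat)
open import Algebra.Bundles.Raw using (RawRing)
open import Data.List.Base using (List; []; _∷_; map)
open import Data.Nat.Base as ℕ using (ℕ)
import Data.Nat.Literals as ℕ
open import Data.Rational.Base as ℚ using (ℚ; 0ℚ; 1ℚ)
open import Data.Unit.Base using (⊤)
open import Data.Vec.Functional using (Vector; fromList)
open import Level using (0ℓ)
open import Relation.Binary.Bundles using (Setoid)
open import Relation.Binary.PropositionalEquality.Core using (_≡_; refl; sym; trans)

-- The polynomial ring ℚ[m].  A polynomial is the list of its coefficients in
-- increasing degree.  Trailing zeros are allowed, so equality of polynomials
-- is equality of all coefficients, not of lists.

Poly : Set
Poly = List ℚ

coeff : Poly → ℕ → ℚ
coeff []      _         = 0ℚ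
coeff (a ∷ _) ℕ.zero    = a
coeff (_ ∷ p) (ℕ.suc n) = coeff p n

infix 4 _≈ₚ_
_≈ₚ_ : Poly → Poly → Set
p ≈ₚ q = ∀ n → coeff p n ≡ coeff q n

infixl 6 _+ₚ_
_+ₚ_ : Poly → Poly → Poly
[]      +ₚ q       = q
(a ∷ p) +ₚ []      = a ∷ p
(a ∷ p) +ₚ (b ∷ q) = (a ℚ.+ b) ∷ (p +ₚ q)

-ₚ_ : Poly → Poly
-ₚ_ = map (λ a → ℚ.- a)

-- (a + m p) q = a q + m (p q)
infixl 7 _*ₚ_
_*ₚ_ : Poly → Poly → Poly
[]      *ₚ q = []
(a ∷ p) *ₚ q = map (a ℚ.*_) q +ₚ (0ℚ ∷ (p *ₚ q))

indeterminate : Poly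
indeterminate = 0ℚ ∷ 1ℚ ∷ []

polyRing : RawRing 0ℓ 0ℓ
polyRing = record
  { Carrier = Poly
  ; _≈_     = _≈ₚ_
  ; _+_     = _+ₚ_
  ; _*_     = _*ₚ_
  ; -_      = -ₚ_
  ; 0#      = []
  ; 1#      = 1ℚ ∷ []
  }

polySetoid : Setoid 0ℓ 0ℓ
polySetoid = record
  { Carrier       = Poly
  ; _≈_           = _≈ₚ_
  ; isEquivalence = record
    { refl  = λ _ → refl
    ; sym   = λ p≈q n → sym (p≈q n)
    ; trans = λ p≈q q≈r n → trans (p≈q n) (q≈r n)
    }
  }

-- The same formulas are read in ℚ, at a rational number m, and in ℚ[m], at the
-- indeterminate.

module Solution (R : RawRing 0ℓ 0ℓ) where

  open RawRing R
  open import Algebra.Definitions.RawSemiring rawSemiring using (_×_)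

  infixl 6 _-_
  _-_ : Carrier → Carrier → Carrier
  a - b = a + (- b)

  -- A numeral n of type Carrier denotes the n-fold sum 1 + ⋯ + 1 in R.
  instance
    numeralℕ : Number ℕ
    numeralℕ = ℕ.number

    numeral : Number Carrier
    numeral = record { Constraint = λ _ → ⊤ ; fromNat = λ n → n × 1# }

  x : Carrier → Vector Carrier 7
  x m = fromList
      ( (4 * m + 3) * (8 * m - 3)
      ∷ - 2 * (2 * m + 3) * (12 * m - 1)
      ∷ - 4 * (3 * m + 1) * (4 * m - 9)
      ∷ 6 * (4 * m + 1) * (8 * m + 1)
      ∷ 3 * (4 * m + 1) * (16 * m - 3)
      ∷ 8 * (4 * m + 3) * (m - 1)
      ∷ - 4 * (16 * m + 9) * (2 * m - 1)
      ∷ [] )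

  y : Carrier → Vector Carrier 7
  y m = fromList
      ( (8 * m + 1) * (4 * m - 9)
      ∷ (16 * m + 9) * (12 * m - 1)
      ∷ 4 * (2 * m + 3) * (4 * m + 3)
      ∷ 8 * (3 * m + 1) * (8 * m - 3)
      ∷ - 6 * (4 * m + 1) * (2 * m - 1)
      ∷ - 2 * (4 * m + 1) * (16 * m - 3)
      ∷ - 12 * (4 * m + 3) * (m - 1)
      ∷ [] )

{-# OPTIONS --safe #-}
module Submission where

open import Defs
open import Data.Nat.Base using (ℕ; suc; _≤_; s≤s)
open import Data.Product.Base using (_×_; _,_)
open import Data.Rational.Base using (ℚ; 0ℚ; 1ℚ; _+_; +-*-rawRing; +-*-rawSemiring)
open import Data.Vec.Functional using (toList)
open import Relation.Binary.PropositionalEquality.Core using (_≡_; refl; cong₂)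
open import Relation.Nullary.Negation.Core using (¬_)
open import Algebra.Definitions.RawSemiring +-*-rawSemiring using (sum; product; _^_)
open import Data.List.Relation.Binary.Permutation.Setoid polySetoid using (_↭_)
open import Algebra.Bundles.Raw using (RawRing)
import Algebra.Definitions.RawSemiring as RawSemiringDefinitions
open import Data.List.Membership.Setoid polySetoid using (_∉_)
open import Data.List.Relation.Binary.Permutation.Setoid.Properties polySetoid using (∈-resp-↭)
import Data.List.Relation.Unary.Any as Any
open import Data.Fin.Base using (zero)
open import Data.Rational.Properties using (_≟_)
open import Data.Rational.Solver using (module +-*-Solver)
open import Level using (0ℓ)
open import Relation.Nullary.Decidable using (from-no)

open +-*-Solver using (Polynomial; con; _:+_; _:*_; :-_; _:=_; solve)

-- The five power-sum equalities and the product equality are polynomial identities in m over ℚ, so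
-- comparing normal forms proves each. For nontriviality, a permutation preserves membership, so it
-- is enough that x₁ is none of the y's; evaluation at m = 1 shows this.

-- Instantiating Solution at the solver's syntax yields terms whose semantics
-- unfolds to Solution +-*-rawRing, so the formulas need not be reified by hand.
syntaxRing : RawRing 0ℓ 0ℓ
syntaxRing = record
  { Carrier = Polynomial 1
  ; _≈_     = _≡_
  ; _+_     = _:+_
  ; _*_     = _:*_
  ; -_      = :-_
  ; 0#      = con 0ℚ
  ; 1#      = con 1ℚ
  }

module Syntactic where
  open Solution syntaxRing public
  open RawSemiringDefinitions (RawRing.rawSemiring syntaxRing) public
    using (sum; product; _^_)

powerSumEquation : ℕ → Polynomial 1 → Polynomial 1 × Polynomial 1
powerSumEquation r m =
  Syntactic.sum (λ i → Syntactic.x m i Syntactic.^ r)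
  := Syntactic.sum (λ i → Syntactic.y m i Syntactic.^ r)

module _ (m : ℚ) where
  open Solution +-*-rawRing

  -- Each exponent is a separate case because `_^_` unfolds to products, in the syntax and in ℚ
  -- alike, only at a literal `r`; the normal forms can then be computed.
  powerSums-≡ : ∀ r → 1 ≤ r → r ≤ 5 →
                sum (λ i → x m i ^ r) ≡ sum (λ i → y m i ^ r)
  powerSums-≡ 1 _ _ = solve 1 (powerSumEquation 1) refl m
  powerSums-≡ 2 _ _ = solve 1 (powerSumEquation 2) refl m
  powerSums-≡ 3 _ _ = solve 1 (powerSumEquation 3) refl m
  powerSums-≡ 4 _ _ = solve 1 (powerSumEquation 4) refl m
  powerSums-≡ 5 _ _ = solve 1 (powerSumEquation 5) refl m
  powerSums-≡ (suc (suc (suc (suc (suc (suc _)))))) _ (s≤s (s≤s (s≤s (s≤s (s≤s ())))))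

  products-≡ : product (x m) ≡ product (y m)
  products-≡ = solve 1
    (λ m → Syntactic.product (Syntactic.x m) := Syntactic.product (Syntactic.y m))
    refl m

-- The value at m = 1 of a polynomial of degree at most 2.  No single coefficient
-- separates the two multisets: in each degree they have the same coefficients.
quadraticAt1 : Poly → ℚ
quadraticAt1 p = coeff p 0 + coeff p 1 + coeff p 2

quadraticAt1-cong : ∀ p q → p ≈ₚ q → quadraticAt1 p ≡ quadraticAt1 q
quadraticAt1-cong _ _ p≈q = cong₂ _+_ (cong₂ _+_ (p≈q 0) (p≈q 1)) (p≈q 2)

module _ where
  open Solution polyRing

  -- At m = 1, x₁ is 35 and the y's are -45, 275, 140, 160, -30, -130, 0.
  x₁∉y : x indeterminate zero ∉ toList (y indeterminate)
  x₁∉y x₁∈y = from-no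
    -- `_≈ₚ_` quantifies over all coefficients; equality of values at m = 1 is a decidable
    -- consequence, so the finite search is settled by computation.
    (Any.any? (λ p → quadraticAt1 (x indeterminate zero) ≟ quadraticAt1 p)
              (toList (y indeterminate)))
    (Any.map (λ {p} → quadraticAt1-cong (x indeterminate zero) p) x₁∈y)

  x-not-↭-y : ¬ (toList (x indeterminate) ↭ toList (y indeterminate))
  x-not-↭-y x↭y = x₁∉y (∈-resp-↭ {x indeterminate zero} x↭y (Any.here (λ _ → refl)))

mainTheorem8 : ((m : ℚ) →
    let open Solution +-*-rawRing in
    ((r : ℕ) → 1 ≤ r → r ≤ 5 → sum (λ i → x m i ^ r) ≡ sum (λ i → y m i ^ r))
    × product (x m) ≡ product (y m))
    ×
    (let open Solution polyRing in
    ¬ (toList (x indeterminate) ↭ toList (y indeterminate)))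
mainTheorem8 = (λ m → powerSums-≡ m , products-≡ m) , x-not-↭-y
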